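{- Let $G$ be a complete $t$-partite graph (with $t$ nonempty parts), $t\ge 3$. Then $sn(G)=t-1$.
   Context: Graphs are finite, undirected and simple. Let $G=(V,E)$ be a connected graph with chromatic number $\chi(G)=k\ge 2$. For $S\subset V$, a partial coloring on $G[S]$ is a proper coloring $\mathscr C_0$ of the induced subgraph $G[S]$ with colors from $\{1,\dots,k\}$ (not all colors need be used). It is a Sudoku coloring of $G$ if there is exactly one proper $k$-coloring $V\to\{1,\dots,k\}$ of $G$ whose restriction to $S$ is $\mathscr C_0$. The Sudoku number $sn(G)$ is the smallest $|S|$ such that $G[S]$ admits a Sudoku coloring of $G$. -}

module Defs where

open import Data.Fin using (Fin)
open import Data.Fin.Subset using (Subset; _∈_; ∣_∣)
open import Data.Nat using (ℕ; _≤_)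
open import Data.Product using (Σ; ∃!; _×_; proj₁)
open import Function.Bundles using (_⇔_)
open import Function.Definitions using (StrictlySurjective)
open import Level using (0ℓ)
open import Relation.Binary.Construct.Closure.ReflexiveTransitive using (Star)
open import Relation.Binary.Core using (Rel)
open import Relation.Binary.Definitions using (Symmetric; Irreflexive)
open import Relation.Binary.PropositionalEquality using (_≡_; _≢_; _≗_)

-- Finiteness is imposed by taking the vertex type to be Fin n; V is kept
-- general so that an induced subgraph is again a Graph.
record Graph (V : Set) : Set₁ where
  field
    Adj         : Rel V 0ℓ
    symmetric   : Symmetric Adj
    irreflexive : Irreflexive _≡_ Adj

open Graph public

-- Any two vertices are joined by a walk.
Connected : {V : Set} → Graph V → Set
Connected {V} G = (u v : V) → Star (Adj G) u v

induced : {n : ℕ} → Graph (Fin n) → (S : Subset n) → Graph (Σ (Fin n) (_∈ S))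
induced G S = record
  { Adj         = λ x y → Adj G (proj₁ x) (proj₁ y)
  ; symmetric   = symmetric G
  ; irreflexive = λ { _≡_.refl → irreflexive G _≡_.refl }
  }

-- A proper colouring with colours from Fin k; not all colours need occur.
Proper : {V : Set} {k : ℕ} → Graph V → (V → Fin k) → Set
Proper {V} G c = {u v : V} → Adj G u v → c u ≢ c v

Colourable : {V : Set} → Graph V → ℕ → Set
Colourable {V} G k = Σ (V → Fin k) (Proper G)

IsLeast : (ℕ → Set) → ℕ → Set
IsLeast P m = P m × ((j : ℕ) → P j → m ≤ j)

IsChromaticNumber : {V : Set} → Graph V → ℕ → Set
IsChromaticNumber G = IsLeast (Colourable G)

-- Colourings are functions, so uniqueness of the extension is up to
-- pointwise equality.
IsSudokuColouring : {n k : ℕ} → Graph (Fin n) → (S : Subset n) →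
                    (Σ (Fin n) (_∈ S) → Fin k) → Set
IsSudokuColouring {n} {k} G S c₀ =
  Proper (induced G S) c₀ ×
  ∃! _≗_ λ (c : Fin n → Fin k) → Proper G c × (∀ x → c (proj₁ x) ≡ c₀ x)

HasSudokuSetOfSize : {n : ℕ} → Graph (Fin n) → (k s : ℕ) → Set
HasSudokuSetOfSize {n} G k s =
  Σ (Subset n) λ S → ∣ S ∣ ≡ s ×
  Σ (Σ (Fin n) (_∈ S) → Fin k) (IsSudokuColouring G S)

-- "sn(G) is defined and equals m".  The Sudoku number is only defined for
-- connected graphs of chromatic number at least 2, so these conditions are
-- part of the assertion.
record IsSudokuNumber {n : ℕ} (G : Graph (Fin n)) (m : ℕ) : Set where
  field
    connected : Connected G
    χ         : ℕ
    isχ       : IsChromaticNumber G χ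
    2≤χ       : 2 ≤ χ
    isLeast   : IsLeast (HasSudokuSetOfSize G χ) m

-- Surjectivity of part says that all t parts are nonempty.
record IsCompleteMultipartite {V : Set} (G : Graph V) (t : ℕ) : Set where
  field
    part       : V → Fin t
    surjective : StrictlySurjective _≡_ part
    adjacent   : (u v : V) → Adj G u v ⇔ (part u ≢ part v)

{-# OPTIONS --safe #-}

-- Choose a representative of every part.  A proper t-colouring is injective on
-- the representatives, hence uses all t colours, and a vertex gets the colour
-- of the representative of its part.  Prescribing the colours of all but one
-- of the representatives therefore determines the colouring.  Conversely, a
-- set of fewer than t - 1 vertices leaves two colours unseen, and exchanging
-- them gives a second extension.
module Submission where

open import Defs
open import Data.Fin using (Fin; zero; suc; toℕ)
open import Data.Fin.Permutation.Components using (transpose; transpose-inverse)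
open import Data.Fin.Properties
  using (_≟_; any?; injective⇒≤; pigeonhole; ¬∀⟶∃¬)
open import Data.Fin.Subset using (Subset; inside; outside; _∈_; _∪_; ⁅_⁆; ⊥; ∣_∣)
open import Data.Fin.Subset.Properties using (p⊆p∪q; q⊆p∪q; x∈⁅x⁆; ∣⁅x⁆∣≡1; ∣⊥∣≡0)
open import Data.Nat using (ℕ; zero; suc; _+_; _≤_; _<_; _∸_; z≤n; s≤s; s<s)
open import Data.Nat.Properties as ℕ using (module ≤-Reasoning)
open import Data.Product using (∃; _×_; _,_; proj₁; proj₂)
open import Data.Vec using ([]; _∷_; here; there)
open import Data.Vec.Functional as F using ()
open import Function using (_∘_)
open import Function.Bundles using (module Equivalence)
open import Function.Definitions using (Injective; StrictlySurjective)
open import Relation.Binary.Construct.Closure.ReflexiveTransitive using (ε; _◅_)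
open import Relation.Binary.PropositionalEquality
  using (_≡_; _≢_; refl; sym; trans; cong; module ≡-Reasoning)
open import Relation.Nullary using (yes; no; contradiction)
open import Relation.Nullary.Decidable using (decidable-stable; dec-true; dec-false)

-- Prepending `y` to the values of `f` gives `suc n` entries in `Fin n`, so two of them agree.
-- Injectivity rules out a collision within `f`, hence `y` itself is hit.
injective⇒surjective : ∀ {n} {f : Fin n → Fin n} →
                       Injective _≡_ _≡_ f → StrictlySurjective _≡_ f
injective⇒surjective {n} {f} inj y with pigeonhole (ℕ.n<1+n n) (y F.∷ f)
... | zero  , suc j , _       , y≡fj  = j , sym y≡fj
... | suc i , suc j , s<s i<j , fi≡fj = contradiction (cong toℕ (inj fi≡fj)) (ℕ.<⇒≢ i<j)

surjective⇒≥ : ∀ {m n} {f : Fin m → Fin n} → StrictlySurjective _≡_ f → n ≤ m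
surjective⇒≥ {f = f} surj = injective⇒≤ {f = proj₁ ∘ surj} λ {y} {z} eq →
  trans (sym (proj₂ (surj y))) (trans (cong f eq) (proj₂ (surj z)))

missedValue : ∀ {m n} (f : Fin m → Fin n) → m < n → ∃ λ y → ∀ x → f x ≢ y
missedValue {n = n} f m<n
  with y , ∄x ← ¬∀⟶∃¬ n (λ y → ∃ λ x → f x ≡ y) (λ y → any? (λ x → f x ≟ y))
                      (ℕ.<⇒≱ m<n ∘ surjective⇒≥)
  = y , λ x fx≡y → ∄x (x , fx≡y)

twoMissedValues : ∀ {m n} (f : Fin m → Fin n) → suc m < n →
                  ∃ λ y → ∃ λ z → y ≢ z × (∀ x → f x ≢ y) × (∀ x → f x ≢ z)
twoMissedValues f 1+m<n
  with y , f≢y  ← missedValue f (ℕ.<-trans (ℕ.n<1+n _) 1+m<n)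
  -- Putting `y` in front of `f` makes the second missed value differ from the first.
  with z , yf≢z ← missedValue (y F.∷ f) 1+m<n
  = y , z , yf≢z zero , f≢y , yf≢z ∘ suc

transpose-injective : ∀ {n} (i j : Fin n) → Injective _≡_ _≡_ (transpose i j)
transpose-injective i j {k} {l} eq = begin
  k                                ≡⟨ transpose-inverse j i ⟨
  transpose j i (transpose i j k)  ≡⟨ cong (transpose j i) eq ⟩
  transpose j i (transpose i j l)  ≡⟨ transpose-inverse j i ⟩
  l                                ∎
  where open ≡-Reasoning

transpose-left : ∀ {n} (i j : Fin n) → transpose i j i ≡ j
transpose-left i j rewrite dec-true (i ≟ i) refl = refl

transpose-fixes : ∀ {n} {i j k : Fin n} → k ≢ i → k ≢ j → transpose i j k ≡ k
transpose-fixes {i = i} {j} {k} k≢i k≢j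
  rewrite dec-false (k ≟ i) k≢i | dec-false (k ≟ j) k≢j = refl

-- Indexing the members by `Fin ∣ p ∣` lets the missed-value lemmas count the colours seen on a
-- subset.
enumerate : ∀ {n} (p : Subset n) → Fin ∣ p ∣ → Fin n
enumerate (inside  ∷ p) zero    = zero
enumerate (inside  ∷ p) (suc i) = suc (enumerate p i)
enumerate (outside ∷ p) i       = suc (enumerate p i)

enumerate-complete : ∀ {n} {p : Subset n} {x} → x ∈ p → ∃ λ i → enumerate p i ≡ x
enumerate-complete here = zero , refl
enumerate-complete {p = inside ∷ p} (there x∈p)
  with i , eq ← enumerate-complete x∈p = suc i , cong suc eq
enumerate-complete {p = outside ∷ p} (there x∈p)
  with i , eq ← enumerate-complete x∈p = i , cong suc eq

∣p∪q∣≤∣p∣+∣q∣ : ∀ {n} (p q : Subset n) → ∣ p ∪ q ∣ ≤ ∣ p ∣ + ∣ q ∣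
∣p∪q∣≤∣p∣+∣q∣ []            []            = z≤n
∣p∪q∣≤∣p∣+∣q∣ (outside ∷ p) (outside ∷ q) = ∣p∪q∣≤∣p∣+∣q∣ p q
∣p∪q∣≤∣p∣+∣q∣ (outside ∷ p) (inside  ∷ q)
  rewrite ℕ.+-suc ∣ p ∣ ∣ q ∣ = s≤s (∣p∪q∣≤∣p∣+∣q∣ p q)
∣p∪q∣≤∣p∣+∣q∣ (inside  ∷ p) (outside ∷ q) = s≤s (∣p∪q∣≤∣p∣+∣q∣ p q)
∣p∪q∣≤∣p∣+∣q∣ (inside  ∷ p) (inside  ∷ q)
  rewrite ℕ.+-suc ∣ p ∣ ∣ q ∣ = s≤s (ℕ.m≤n⇒m≤1+n (∣p∪q∣≤∣p∣+∣q∣ p q))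

image : ∀ {m n} → (Fin m → Fin n) → Subset n
image {zero}  f = ⊥
image {suc m} f = ⁅ f zero ⁆ ∪ image (f ∘ suc)

∈-image : ∀ {m n} (f : Fin m → Fin n) i → f i ∈ image f
∈-image f zero    = p⊆p∪q _ (x∈⁅x⁆ (f zero))
∈-image f (suc i) = q⊆p∪q ⁅ f zero ⁆ _ (∈-image (f ∘ suc) i)

∣image∣≤ : ∀ {m n} (f : Fin m → Fin n) → ∣ image f ∣ ≤ m
∣image∣≤ {zero}  {n} f = ℕ.≤-reflexive (∣⊥∣≡0 n)
∣image∣≤ {suc m} f     = begin
  ∣ ⁅ f zero ⁆ ∪ image (f ∘ suc) ∣      ≤⟨ ∣p∪q∣≤∣p∣+∣q∣ ⁅ f zero ⁆ _ ⟩
  ∣ ⁅ f zero ⁆ ∣ + ∣ image (f ∘ suc) ∣  ≡⟨ cong (_+ ∣ image (f ∘ suc) ∣) (∣⁅x⁆∣≡1 (f zero)) ⟩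
  suc ∣ image (f ∘ suc) ∣               ≤⟨ s≤s (∣image∣≤ (f ∘ suc)) ⟩
  suc m                                 ∎
  where open ≤-Reasoning

-- If two colours were absent from `S`, exchanging them would keep the colouring proper and
-- unchanged on `S`, against uniqueness.
sudoku⇒k≤1+∣S∣ : ∀ {n k} (G : Graph (Fin n)) →
  ({c : Fin n → Fin k} → Proper G c → StrictlySurjective _≡_ c) →
  ∀ S {c₀} → IsSudokuColouring {k = k} G S c₀ → k ≤ suc ∣ S ∣
sudoku⇒k≤1+∣S∣ {k = k} G surj S {c₀} (_ , c , (proper , extends) , unique) = ℕ.≮⇒≥ tooSmall
  where
  tooSmall : suc ∣ S ∣ < k → _
  tooSmall 1+∣S∣<k
    with a , b , a≢b , ≢a , ≢b ← twoMissedValues (c ∘ enumerate S) 1+∣S∣<k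
    -- Some vertex outside `S` has colour `a`, so the exchange really changes the colouring.
    with v , cv≡a ← surj proper a
    = a≢b (begin
        a                    ≡⟨ cv≡a ⟨
        c v                  ≡⟨ unique (swapped-proper , swapped-extends) v ⟩
        transpose a b (c v)  ≡⟨ cong (transpose a b) cv≡a ⟩
        transpose a b a      ≡⟨ transpose-left a b ⟩
        b                    ∎)
    where
    open ≡-Reasoning

    swapped-proper : Proper G (transpose a b ∘ c)
    swapped-proper uv = proper uv ∘ transpose-injective a b

    swapped-extends : ∀ x → transpose a b (c (proj₁ x)) ≡ c₀ x
    swapped-extends x@(_ , x∈S) with i , refl ← enumerate-complete {p = S} x∈S =
      trans (transpose-fixes (≢a i) (≢b i)) (extends x)

module CompleteMultipartite {n t} {G : Graph (Fin n)}
                            (multipartite : IsCompleteMultipartite G t) where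

  open IsCompleteMultipartite multipartite

  rep : Fin t → Fin n
  rep i = proj₁ (surjective i)

  part-rep : ∀ i → part (rep i) ≡ i
  part-rep i = proj₂ (surjective i)

  distinctParts⇒adj : ∀ {u v} → part u ≢ part v → Adj G u v
  distinctParts⇒adj = Equivalence.from (adjacent _ _)

  connected : 2 ≤ t → Connected G
  connected 2≤t u v with part u ≟ part v
  ... | no  u≢v = distinctParts⇒adj u≢v ◅ ε
  -- Within one part, detour through a second part: a one-element family of parts misses some `i`.
  ... | yes u≡v with i , u≢i ← missedValue {1} (λ _ → part u) 2≤t =
    distinctParts⇒adj u≢w ◅ distinctParts⇒adj (λ w≡v → u≢w (trans u≡v (sym w≡v))) ◅ ε
    where
    u≢w : part u ≢ part (rep i)
    u≢w u≡w = u≢i zero (trans u≡w (part-rep i))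

  part-proper : Proper G part
  part-proper = Equivalence.to (adjacent _ _)

  sameColour⇒samePart : ∀ {k} {c : Fin n → Fin k} → Proper G c →
                        ∀ {u v} → c u ≡ c v → part u ≡ part v
  sameColour⇒samePart proper cu≡cv =
    decidable-stable (_ ≟ _) λ u≢v → proper (distinctParts⇒adj u≢v) cu≡cv

  -- The representatives form a clique with one vertex per part.
  colouredReps-injective : ∀ {k} {c : Fin n → Fin k} → Proper G c →
                           Injective _≡_ _≡_ (c ∘ rep)
  colouredReps-injective proper {i} {j} eq =
    trans (sym (part-rep i)) (trans (sameColour⇒samePart proper eq) (part-rep j))

  chromaticNumber : IsChromaticNumber G t
  chromaticNumber =
    (part , part-proper) , λ _ (_ , proper) → injective⇒≤ (colouredReps-injective proper)

  module _ {c : Fin n → Fin t} (proper : Proper G c) where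

    colouredReps-surjective : StrictlySurjective _≡_ (c ∘ rep)
    colouredReps-surjective = injective⇒surjective (colouredReps-injective proper)

    proper⇒surjective : StrictlySurjective _≡_ c
    proper⇒surjective a with i , eq ← colouredReps-surjective a = rep i , eq

    -- The colour of `v` already occurs on some representative, and vertices sharing a colour share
    -- a part.
    colour-rep-part : ∀ v → c v ≡ c (rep (part v))
    colour-rep-part v with i , eq ← colouredReps-surjective (c v) =
      trans (sym eq) (cong (c ∘ rep)
        (trans (sym (part-rep i)) (sameColour⇒samePart proper eq)))

-- Used for the one representative left uncoloured: every colour but `zero` is already taken.
injectiveFixingSuc⇒id : ∀ {m} {f : Fin (suc m) → Fin (suc m)} → Injective _≡_ _≡_ f →
                        (∀ i → f (suc i) ≡ suc i) → ∀ i → f i ≡ i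
injectiveFixingSuc⇒id inj fix (suc i) = fix i
injectiveFixingSuc⇒id {f = f} inj fix zero with f zero in eq
... | zero  = refl
... | suc i = contradiction (inj (trans eq (sym (fix i)))) λ ()

module _ {n m} {G : Graph (Fin n)} (multipartite : IsCompleteMultipartite G (suc m)) where

  open IsCompleteMultipartite multipartite using (part)
  open CompleteMultipartite multipartite

  nonzeroReps : Subset n
  nonzeroReps = image (rep ∘ suc)

  part-sudoku : IsSudokuColouring G nonzeroReps (part ∘ proj₁)
  part-sudoku = part-proper , part , (part-proper , λ _ → refl) , unique
    where
    unique : ∀ {c} → Proper G c × (∀ x → c (proj₁ x) ≡ part (proj₁ x)) →
             ∀ v → part v ≡ c v
    -- The map `c ∘ rep` is the identity, so `c v` is the index of the part of `v`.
    unique {c} (proper , extends) v = sym (trans (colour-rep-part proper v)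
      (injectiveFixingSuc⇒id (colouredReps-injective proper) fix (part v)))
      where
      fix : ∀ i → c (rep (suc i)) ≡ suc i
      fix i = trans (extends (_ , ∈-image (rep ∘ suc) i)) (part-rep (suc i))

  m≤∣sudoku∣ : ∀ S {c₀} → IsSudokuColouring {k = suc m} G S c₀ → m ≤ ∣ S ∣
  m≤∣sudoku∣ S = ℕ.≤-pred ∘ sudoku⇒k≤1+∣S∣ G proper⇒surjective S

  sudokuNumber : 2 ≤ suc m → IsSudokuNumber G m
  sudokuNumber 2≤1+m = record
    { connected = connected 2≤1+m
    ; χ         = suc m
    ; isχ       = chromaticNumber
    ; 2≤χ       = 2≤1+m
    ; isLeast   =
        ( nonzeroReps
        -- The lower bound for all Sudoku sets, applied to this one, shows that its size is exactly
        -- `m`.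
        , ℕ.≤-antisym (∣image∣≤ (rep ∘ suc)) (m≤∣sudoku∣ nonzeroReps part-sudoku)
        , _ , part-sudoku )
      , λ { _ (S , refl , _ , sudoku) → m≤∣sudoku∣ S sudoku }
    }

corollary3p4 : (n t : ℕ) (G : Graph (Fin n)) → 3 ≤ t →
    IsCompleteMultipartite G t → IsSudokuNumber G (t ∸ 1)
corollary3p4 n (suc m) G 3≤t multipartite =
  sudokuNumber multipartite (ℕ.<⇒≤ 3≤t)
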